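{- Let $k>2$ be an even integer and let $n$ be a positive integer that is a multiple of $k$. Then $$(n/k)!\;\leq\; M(n,k)\;\leq\; 3^n\,(n/k)!,$$ where $M(n,k)$ is the maximum size of a family of Hamilton paths in the complete graph $K_n$ such that for any two distinct members of the family there is a subpath with $k$ edges (on $k+1$ vertices) of one of the two Hamilton paths that is edge-disjoint from the whole of the other Hamilton path.
   Context: $K_n$ is the complete graph with vertex set $[n]=\{1,\dots,n\}$. Hamilton paths are undirected: a Hamilton path in $K_n$ is a subgraph that is a path visiting all $n$ vertices, identified with its edge set (so a vertex ordering and its reversal give the same Hamilton path). A subpath with $k$ edges of a Hamilton path consists of $k$ consecutive edges of it. -}

module Defs where

open import Data.Fin.Base using (Fin; toℕ; finToFun; funToFin)
open import Data.Fin.Permutation using (Permutation′; permutation; _⟨$⟩ʳ_; _⟨$⟩ˡ_; inverseˡ; inverseʳ; _≈_)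
  renaming (id to idₚ)
open import Data.Fin.Properties using (_≟_; any?; all?; finToFun-funToFin; injective⇒≤)
open import Data.Nat.Base using (ℕ; zero; suc; _+_; _^_; _≤_; _<_)
open import Data.Nat.Properties using (_≤?_; _<?_; ≤-pred; ≤∧≢⇒<)
import Data.Nat.Properties as ℕ
open import Data.Product.Base using (∃; ∃₂; _×_; _,_; proj₁; proj₂)
open import Data.Sum.Base using (_⊎_)
import Data.Sum.Base as Sum
open import Function.Base using (_∘_)
open import Function.Definitions using (Injective)
open import Level using (0ℓ)
open import Relation.Binary.Core using (Rel; _⇒_; _⇔_)
open import Relation.Binary.Definitions using (Decidable)
open import Relation.Binary.PropositionalEquality.Core
  using (_≡_; _≢_; refl; sym; trans; cong; subst)
open import Relation.Nullary using (¬_; Dec; yes; no; contradiction)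
open import Relation.Nullary.Decidable using (map′; ¬?; _×-dec_; _⊎-dec_; _→-dec_)

private
  variable
    n : ℕ

-- A Hamilton path of the complete graph on Fin n is given by a vertex ordering:
-- π ⟨$⟩ʳ i is the i-th vertex visited.  Orderings are never compared by _≡_ but
-- by _∼_ below, so an ordering and its reversal count as the same path.
HamiltonPath : ℕ → Set
HamiltonPath n = Permutation′ n

-- Sets of edges are represented by symmetric relations on the vertices:
-- {u,v} = {π(i),π(j)} as unordered pairs.
Joins : HamiltonPath n → Fin n → Fin n → Rel (Fin n) 0ℓ
Joins π i j u v = (π ⟨$⟩ʳ i ≡ u × π ⟨$⟩ʳ j ≡ v) ⊎ (π ⟨$⟩ʳ i ≡ v × π ⟨$⟩ʳ j ≡ u)

Edges : HamiltonPath n → Rel (Fin n) 0ℓ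
Edges π u v = ∃₂ λ i j → toℕ j ≡ suc (toℕ i) × Joins π i j u v

-- The k edges of the subpath on positions s, s+1, …, s+k (when s + k < n).
SubpathEdges : HamiltonPath n → (s k : ℕ) → Rel (Fin n) 0ℓ
SubpathEdges π s k u v = ∃₂ λ i j →
  (s ≤ toℕ i × toℕ i < s + k) × toℕ j ≡ suc (toℕ i) × Joins π i j u v

infix 4 _∼_

_∼_ : Rel (HamiltonPath n) 0ℓ
π ∼ ρ = Edges π ⇔ Edges ρ

EdgeDisjoint : Rel (Fin n) 0ℓ → Rel (Fin n) 0ℓ → Set
EdgeDisjoint E F = ∀ u v → E u v → ¬ F u v

HasSubpathAvoiding : ℕ → Rel (HamiltonPath n) 0ℓ
HasSubpathAvoiding {n} k π ρ = ∃ λ (s : Fin n) →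
  toℕ s + k < n × EdgeDisjoint (SubpathEdges π (toℕ s) k) (Edges ρ)

Separated : ℕ → Rel (HamiltonPath n) 0ℓ
Separated k π ρ = HasSubpathAvoiding k π ρ ⊎ HasSubpathAvoiding k ρ π

record SeparatedFamily (n k size : ℕ) : Set where
  field
    path      : Fin size → HamiltonPath n
    distinct  : Injective _≡_ _∼_ path
    separated : ∀ i j → i ≢ j → Separated k (path i) (path j)

IsMaximum : (ℕ → Set) → ℕ → Set
IsMaximum P m = P m × (∀ m′ → P m′ → m′ ≤ m)

------------------------------------------------------------------------
-- The maximum size of a family exists: a family has at most n ^ n members,
-- and the existence of a family of given size is decidable.

private

  bounded-maximum : {P : ℕ → Set} → (∀ m → Dec (P m)) → P 0 →
                    ∀ b → (∀ m → P m → m ≤ b) → ∃ (IsMaximum P)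
  bounded-maximum P? p0 zero    ≤b = 0 , p0 , ≤b
  bounded-maximum P? p0 (suc b) ≤b with P? (suc b)
  ... | yes p = suc b , p , ≤b
  ... | no ¬p = bounded-maximum P? p0 b
    (λ m pm → ≤-pred (≤∧≢⇒< (≤b m pm) (λ { refl → ¬p pm })))

  joins? : (π : HamiltonPath n) → ∀ i j → Decidable (Joins π i j)
  joins? π i j u v =
    ((π ⟨$⟩ʳ i ≟ u) ×-dec (π ⟨$⟩ʳ j ≟ v)) ⊎-dec ((π ⟨$⟩ʳ i ≟ v) ×-dec (π ⟨$⟩ʳ j ≟ u))

  edges? : (π : HamiltonPath n) → Decidable (Edges π)
  edges? π u v = any? λ i → any? λ j → (toℕ j ℕ.≟ suc (toℕ i)) ×-dec joins? π i j u v

  subpathEdges? : (π : HamiltonPath n) → ∀ s k → Decidable (SubpathEdges π s k)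
  subpathEdges? π s k u v = any? λ i → any? λ j →
    ((s ≤? toℕ i) ×-dec (toℕ i <? s + k)) ×-dec
    ((toℕ j ℕ.≟ suc (toℕ i)) ×-dec joins? π i j u v)

  ⇒? : {E F : Rel (Fin n) 0ℓ} → Decidable E → Decidable F → Dec (E ⇒ F)
  ⇒? E? F? = map′ (λ f {u} {v} → f u v) (λ f u v → f {u} {v})
    (all? λ u → all? λ v → E? u v →-dec F? u v)

  ∼? : Decidable (_∼_ {n})
  ∼? π ρ = ⇒? (edges? π) (edges? ρ) ×-dec ⇒? (edges? ρ) (edges? π)

  hasSubpathAvoiding? : ∀ k → Decidable (HasSubpathAvoiding {n} k)
  hasSubpathAvoiding? {n} k π ρ = any? λ s → (toℕ s + k <? n) ×-dec
    (all? λ u → all? λ v → subpathEdges? π (toℕ s) k u v →-dec ¬? (edges? ρ u v))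

  separated? : ∀ k → Decidable (Separated {n} k)
  separated? k π ρ = hasSubpathAvoiding? k π ρ ⊎-dec hasSubpathAvoiding? k ρ π

  joins-resp : {π ρ : HamiltonPath n} → π ≈ ρ → ∀ i j → Joins π i j ⇒ Joins ρ i j
  joins-resp {π = π} {ρ} π≈ρ i j = Sum.map step step
    where
    step : ∀ {x y} → π ⟨$⟩ʳ i ≡ x × π ⟨$⟩ʳ j ≡ y → ρ ⟨$⟩ʳ i ≡ x × ρ ⟨$⟩ʳ j ≡ y
    step (p , q) = trans (sym (π≈ρ i)) p , trans (sym (π≈ρ j)) q

  edges-resp : {π ρ : HamiltonPath n} → π ≈ ρ → Edges π ⇒ Edges ρ
  edges-resp {π = π} {ρ} π≈ρ (i , j , e , x) = i , j , e , joins-resp {π = π} {ρ} π≈ρ i j x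

  ≈⇒∼ : {π ρ : HamiltonPath n} → π ≈ ρ → π ∼ ρ
  ≈⇒∼ {π = π} {ρ} π≈ρ =
    edges-resp {π = π} {ρ} π≈ρ , edges-resp {π = ρ} {π} (sym ∘ π≈ρ)

  avoiding-resp : ∀ k {π π′ ρ ρ′ : HamiltonPath n} → π ≈ π′ → ρ ≈ ρ′ →
                  HasSubpathAvoiding k π ρ → HasSubpathAvoiding k π′ ρ′
  avoiding-resp k {π} {π′} {ρ} {ρ′} π≈π′ ρ≈ρ′ (s , lt , dis) = s , lt ,
    λ u v (i , j , b , e , x) y →
      dis u v (i , j , b , e , joins-resp {π = π′} {π} (sym ∘ π≈π′) i j x)
              (edges-resp {π = ρ′} {ρ} (sym ∘ ρ≈ρ′) y)

  separated-resp : ∀ k {π π′ ρ ρ′ : HamiltonPath n} → π ≈ π′ → ρ ≈ ρ′ →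
                   Separated k π ρ → Separated k π′ ρ′
  separated-resp k {π} {π′} {ρ} {ρ′} p q =
    Sum.map (avoiding-resp k {π} {π′} {ρ} {ρ′} p q) (avoiding-resp k {ρ} {ρ′} {π} {π′} q p)

  Inverses : (f g : Fin n → Fin n) → Set
  Inverses f g = (∀ x → f (g x) ≡ x) × (∀ x → g (f x) ≡ x)

  invertible? : (f : Fin n → Fin n) → Dec (∃ λ (d : Fin (n ^ n)) → Inverses f (finToFun d))
  invertible? f = any? λ d →
    all? (λ x → f (finToFun d x) ≟ x) ×-dec all? (λ x → finToFun d (f x) ≟ x)

  invertOr-id : (f : Fin n → Fin n) → Dec (∃ λ d → Inverses f (finToFun d)) → HamiltonPath n
  invertOr-id f (yes (d , l , r)) = permutation f (finToFun d) l r
  invertOr-id f (no _)            = idₚ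

  -- Every ordering is, up to _≈_, the decoding of its code; codes of
  -- non-bijective functions decode to the identity.
  decode : Fin (n ^ n) → HamiltonPath n
  decode c = invertOr-id (finToFun c) (invertible? (finToFun c))

  encode : HamiltonPath n → Fin (n ^ n)
  encode π = funToFin (π ⟨$⟩ʳ_)

  invertOr-id-≗ : (f : Fin n → Fin n) (d? : Dec (∃ λ d → Inverses f (finToFun d))) →
                  ∃ (λ d → Inverses f (finToFun d)) → ∀ i → invertOr-id f d? ⟨$⟩ʳ i ≡ f i
  invertOr-id-≗ f (yes _) _ i = refl
  invertOr-id-≗ f (no ¬p) p   = contradiction p ¬p

  decode-encode : (π : HamiltonPath n) → decode (encode π) ≈ π
  decode-encode π i = trans
    (invertOr-id-≗ (finToFun (encode π)) (invertible? (finToFun (encode π))) inverse i)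
    (finToFun-funToFin (π ⟨$⟩ʳ_) i)
    where
    inverse : ∃ λ d → Inverses (finToFun (encode π)) (finToFun d)
    inverse = funToFin (π ⟨$⟩ˡ_)
      , (λ x → trans (finToFun-funToFin (π ⟨$⟩ʳ_) _)
                     (trans (cong (π ⟨$⟩ʳ_) (finToFun-funToFin (π ⟨$⟩ˡ_) x)) (inverseʳ π)))
      , (λ x → trans (finToFun-funToFin (π ⟨$⟩ˡ_) _)
                     (trans (cong (π ⟨$⟩ˡ_) (finToFun-funToFin (π ⟨$⟩ʳ_) x)) (inverseˡ π)))

  ∼-trans : {π ρ σ : HamiltonPath n} → π ∼ ρ → ρ ∼ σ → π ∼ σ
  ∼-trans (f , f′) (g , g′) = (λ x → g (f x)) , (λ x → f′ (g′ x))

  ≈-sym : {π ρ : HamiltonPath n} → π ≈ ρ → ρ ≈ π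
  ≈-sym p i = sym (p i)

  ≡encode⇒≈ : (π ρ : HamiltonPath n) → encode π ≡ encode ρ → π ≈ ρ
  ≡encode⇒≈ π ρ eq i = trans (sym (finToFun-funToFin (π ⟨$⟩ʳ_) i))
    (trans (cong (λ c → finToFun c i) eq) (finToFun-funToFin (ρ ⟨$⟩ʳ_) i))

  family? : ∀ n k m → Dec (SeparatedFamily n k m)
  family? n k m = map′ to from (any? good?)
    where
    paths : Fin ((n ^ n) ^ m) → Fin m → HamiltonPath n
    paths c i = decode (finToFun c i)

    Good : Fin ((n ^ n) ^ m) → Set
    Good c = (∀ i j → paths c i ∼ paths c j → i ≡ j)
           × (∀ i j → i ≢ j → Separated k (paths c i) (paths c j))

    good? : ∀ c → Dec (Good c)
    good? c = (all? λ i → all? λ j → ∼? (paths c i) (paths c j) →-dec (i ≟ j))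
      ×-dec (all? λ i → all? λ j → ¬? (i ≟ j) →-dec separated? k (paths c i) (paths c j))

    to : ∃ Good → SeparatedFamily n k m
    to (c , d , s) = record { path = paths c ; distinct = λ {i} {j} → d i j ; separated = s }

    from : SeparatedFamily n k m → ∃ Good
    from F = c
      , (λ i j i∼j → distinct
          (∼-trans {π = path i} {paths c i} {path j}
            (≈⇒∼ {π = path i} {paths c i} (≈-sym {π = paths c i} {path i} (same i)))
            (∼-trans {π = paths c i} {paths c j} {path j} i∼j
              (≈⇒∼ {π = paths c j} {path j} (same j)))))
      , (λ i j i≢j → separated-resp k {path i} {paths c i} {path j} {paths c j}
          (≈-sym {π = paths c i} {path i} (same i)) (≈-sym {π = paths c j} {path j} (same j))
          (separated i j i≢j))
      where
      open SeparatedFamily F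
      c = funToFin (encode ∘ path)
      same : ∀ i → paths c i ≈ path i
      same i = subst (λ d → decode d ≈ path i)
        (sym (finToFun-funToFin (encode ∘ path) i)) (decode-encode (path i))

  family-bound : ∀ n k m → SeparatedFamily n k m → m ≤ n ^ n
  family-bound n k m F = injective⇒≤ {f = encode ∘ path} λ {i} {j} eq →
    distinct (≈⇒∼ {π = path i} {path j} (≡encode⇒≈ (path i) (path j) eq))
    where open SeparatedFamily F

  maximum : ∀ n k → ∃ (IsMaximum (SeparatedFamily n k))
  maximum n k = bounded-maximum (family? n k)
    (record { path = λ () ; distinct = λ { {()} } ; separated = λ () })
    (n ^ n) (family-bound n k)

M : ℕ → ℕ → ℕ
M n k = proj₁ (maximum n k)

M-isMaximum : ∀ n k → IsMaximum (SeparatedFamily n k) (M n k)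
M-isMaximum n k = proj₂ (maximum n k)

-- Write n = q k and cut both the positions and the vertices into q blocks of length k.
--
-- Lower bound: a permutation σ of the blocks gives the path that visits vertex (i , r) at position
-- (i , r) when r is even and vertex (σ i , r) when r is odd.  Each vertex keeps its residue r, so
-- for k > 2 an edge common to the paths of σ and τ is traversed in the same direction by both, and
-- its even endpoint, which neither path moves, forces it to be at the same position in both.  If σ
-- and τ disagree at a block i other than the last, the k edges starting in block i of the path of
-- σ are therefore not in the path of τ.
--
-- Upper bound: the q - 1 edges joining consecutive blocks of a path meet every subpath with k
-- edges, so two separated paths cannot have the same set of such edges.  That set is determined
-- by a 3-colouring of the vertices (tail, head, neither) and a bijection from tails to heads, so it
-- takes at most 3 ^ n * (q - 1) ! values.

module Submission where

open import Defs
open import Data.Nat.Base using (ℕ; NonZero; _≤_; _>_; _*_; _^_; _/_; _!)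
open import Data.Nat.Divisibility using (_∣_)
open import Data.Product.Base using (_×_)

open import Data.Fin.Base
  using (Fin; zero; suc; toℕ; fromℕ; fromℕ<; inject₁; combine; remQuot; punchIn; funToFin; finToFun)
open import Data.Fin.Patterns using (0F; 1F; 2F)
open import Data.Fin.Permutation
  using (Permutation′; permutation; _⟨$⟩ʳ_; _⟨$⟩ˡ_; inverseˡ; inverseʳ; _≈_; flip; _∘ₚ_;
         insert; remove; insert-punchIn; punchIn-permute)
  renaming (id to idₚ)
open import Data.Fin.Properties
  using (_≟_; any?; ¬∀⟶∃¬; toℕ<n; toℕ-injective; toℕ-fromℕ; toℕ-fromℕ<; toℕ-inject₁;
         inject₁-injective; suc-injective; toℕ-combine; combine-injective; combine-surjective;
         remQuot-combine; combine-remQuot; punchIn-injective; finToFun-funToFin; injective⇒≤)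
open import Data.Nat.Base using (zero; suc; _+_; _<_; _%_; parity; s≤s; z≤n; z<s)
open import Data.Nat.Divisibility using (divides)
open import Data.Nat.DivMod
  using (m≡m%n+[m/n]*n; m/n*n≤m; m%n<n; [m+kn]%n≡m%n; m<n⇒m%n≡m; n%n≡0; m*n/n≡m; m<n*o⇒m/o<n)
open import Data.Nat.Properties
  using (≤-refl; ≤-trans; ≤-antisym; ≤-pred; <-trans; <⇒≢; ≮⇒≥; ≤∧≢⇒<; n<1+n; m≤m+n; m<m+n;
         +-comm; +-identityʳ; +-suc; *-comm; *-suc; +-monoʳ-<; +-monoʳ-≤; *-monoʳ-<; *-monoʳ-≤; +-cancelʳ-<; +-monoˡ-≤;
         *-cancelˡ-<; m≤n*m; _<?_; module ≤-Reasoning)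
import Data.Nat.Properties as ℕ using (suc-injective)
open import Data.Parity.Base using (Parity; 0ℙ; 1ℙ; _⁻¹)
open import Data.Parity.Properties using (suc-homo-⁻¹; *-homo-*; ⁻¹-selfInverse; *-zeroʳ)
open import Data.Product.Base using (∃; _,_; proj₁; proj₂)
open import Data.Sum.Base using (_⊎_; inj₁; inj₂; [_,_]′)
open import Function.Base using (_∘_)
open import Function.Definitions using (Injective)
open import Relation.Binary.Definitions using (DecidableEquality)
open import Relation.Binary.PropositionalEquality
  using (_≡_; _≢_; refl; sym; trans; cong; cong₂; subst; module ≡-Reasoning)
open import Relation.Nullary using (¬_; Dec; yes; no; contradiction)
open import Relation.Nullary.Decidable using (decidable-stable)

private
  variable
    n q k : ℕ

-- Permutations coded by numbers below a factorial

injective : (π : Permutation′ n) → Injective _≡_ _≡_ (π ⟨$⟩ʳ_)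
injective π {x} {y} eq = trans (sym (inverseˡ π)) (trans (cong (π ⟨$⟩ˡ_) eq) (inverseˡ π))

-- The Lehmer code. It counts matchings in the upper bound, while `decode` indexes the family of the
-- lower bound.
encode : Permutation′ n → Fin (n !)
encode {zero}  π = zero
encode {suc n} π = combine (π ⟨$⟩ʳ zero) (encode (remove zero π))

encode-injective : (π ρ : Permutation′ n) → encode π ≡ encode ρ → π ≈ ρ
encode-injective {suc n} π ρ eq i
  with π0≡ρ0 , eq′ ← combine-injective (π ⟨$⟩ʳ zero) _ (ρ ⟨$⟩ʳ zero) _ eq
  with i
... | zero  = π0≡ρ0
... | suc i = begin
  π ⟨$⟩ʳ suc i                                       ≡⟨ punchIn-permute π zero i ⟩
  punchIn (π ⟨$⟩ʳ zero) (remove zero π ⟨$⟩ʳ i)       ≡⟨ cong₂ punchIn π0≡ρ0 (encode-injective _ _ eq′ i) ⟩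
  punchIn (ρ ⟨$⟩ʳ zero) (remove zero ρ ⟨$⟩ʳ i)       ≡⟨ punchIn-permute ρ zero i ⟨
  ρ ⟨$⟩ʳ suc i                                       ∎
  where open ≡-Reasoning

decode : Fin (n !) → Permutation′ n
decode {zero}  c = idₚ
decode {suc n} c = insert zero (proj₁ (remQuot (n !) c)) (decode (proj₂ (remQuot {suc n} (n !) c)))

decode-injective : (c d : Fin (n !)) → decode {n} c ≈ decode d → c ≡ d
decode-injective {zero}  zero zero _ = refl
decode-injective {suc n} c d eq = begin
  c                    ≡⟨ combine-remQuot {suc n} (n !) c ⟨
  combine c₁ c₂        ≡⟨ cong₂ combine c₁≡d₁ (decode-injective c₂ d₂ tails) ⟩
  combine d₁ d₂        ≡⟨ combine-remQuot {suc n} (n !) d ⟩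
  d                    ∎
  where
  open ≡-Reasoning
  c₁ d₁ : Fin (suc n)
  c₁ = proj₁ (remQuot (n !) c)
  d₁ = proj₁ (remQuot (n !) d)
  c₂ d₂ : Fin (n !)
  c₂ = proj₂ (remQuot {suc n} (n !) c)
  d₂ = proj₂ (remQuot {suc n} (n !) d)
  c₁≡d₁ : c₁ ≡ d₁
  c₁≡d₁ = eq zero
  tails : decode c₂ ≈ decode d₂
  tails i = punchIn-injective c₁ _ _ (begin
    punchIn c₁ (decode c₂ ⟨$⟩ʳ i)                ≡⟨ insert-punchIn zero c₁ (decode c₂) i ⟨
    decode {suc n} c ⟨$⟩ʳ suc i                  ≡⟨ eq (suc i) ⟩
    decode {suc n} d ⟨$⟩ʳ suc i                  ≡⟨ insert-punchIn zero d₁ (decode d₂) i ⟩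
    punchIn d₁ (decode d₂ ⟨$⟩ʳ i)                ≡⟨ cong (λ x → punchIn x (decode d₂ ⟨$⟩ʳ i)) c₁≡d₁ ⟨
    punchIn c₁ (decode d₂ ⟨$⟩ʳ i)                ∎)

-- Lower bound

-- A position or vertex combine i r of Fin (q * k) lies in block i with residue r.
blockwise : (Fin k → Permutation′ q) → HamiltonPath (q * k)
blockwise {k} {q} τ = permutation (apply to) (apply from)
  (cancel to from (λ r _ → inverseʳ (τ r))) (cancel from to (λ r _ → inverseˡ (τ r)))
  where
  to from : Fin k → Fin q → Fin q
  to r   = τ r ⟨$⟩ʳ_
  from r = τ r ⟨$⟩ˡ_

  apply : (Fin k → Fin q → Fin q) → Fin (q * k) → Fin (q * k)
  apply f p = combine (f (proj₂ (remQuot {q} k p)) (proj₁ (remQuot k p))) (proj₂ (remQuot {q} k p))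

  cancel : ∀ f g → (∀ r i → f r (g r i) ≡ i) → ∀ p → apply f (apply g p) ≡ p
  cancel f g inv p = begin
    apply f (combine (g r i) r)  ≡⟨ cong (λ (i , r) → combine (f r i) r) (remQuot-combine (g r i) r) ⟩
    combine (f r (g r i)) r      ≡⟨ cong (λ i → combine i r) (inv r i) ⟩
    combine i r                  ≡⟨ combine-remQuot {q} k p ⟩
    p                            ∎
    where
    open ≡-Reasoning
    i = proj₁ (remQuot {q} k p)
    r = proj₂ (remQuot {q} k p)

onOdd : Permutation′ q → Parity → Permutation′ q
onOdd σ 0ℙ = idₚ
onOdd σ 1ℙ = σ

interleave : Permutation′ q → HamiltonPath (q * k)
interleave σ = blockwise (onOdd σ ∘ parity ∘ toℕ)

interleave-combine : (σ : Permutation′ q) (i : Fin q) (r : Fin k) →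
  interleave {k = k} σ ⟨$⟩ʳ combine i r ≡ combine (onOdd σ (parity (toℕ r)) ⟨$⟩ʳ i) r
interleave-combine σ i r =
  cong (λ (i , r) → combine (onOdd σ (parity (toℕ r)) ⟨$⟩ʳ i) r) (remQuot-combine i r)

same-vertex : (σ τ : Permutation′ q) (i j : Fin q) (r s : Fin k) →
  interleave σ ⟨$⟩ʳ combine i r ≡ interleave τ ⟨$⟩ʳ combine j s →
  onOdd σ (parity (toℕ r)) ⟨$⟩ʳ i ≡ onOdd τ (parity (toℕ s)) ⟨$⟩ʳ j × r ≡ s
same-vertex σ τ i j r s eq = combine-injective _ r _ s
  (trans (sym (interleave-combine σ i r)) (trans eq (interleave-combine τ j s)))

toℕ-combine-% : .{{_ : NonZero k}} (i : Fin q) (r : Fin k) → toℕ (combine i r) % k ≡ toℕ r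
toℕ-combine-% {k} i r = begin
  toℕ (combine i r) % k        ≡⟨ cong (_% k) (trans (toℕ-combine i r) (+-comm _ (toℕ r))) ⟩
  (toℕ r + k * toℕ i) % k      ≡⟨ cong (λ m → (toℕ r + m) % k) (*-comm k (toℕ i)) ⟩
  (toℕ r + toℕ i * k) % k      ≡⟨ [m+kn]%n≡m%n (toℕ r) (toℕ i) k ⟩
  toℕ r % k                    ≡⟨ m<n⇒m%n≡m (toℕ<n r) ⟩
  toℕ r                        ∎
  where open ≡-Reasoning

-- If residue `r + 1` is still below `k`, injectivity of `combine` settles the claim; otherwise `r`
-- is the last residue and reduction modulo `k` gives `r′`.
consecutive : (i i′ : Fin q) (r r′ : Fin k) → toℕ (combine i′ r′) ≡ suc (toℕ (combine i r)) →
  (i ≡ i′ × toℕ r′ ≡ suc (toℕ r)) ⊎ (suc (toℕ r) ≡ k × toℕ r′ ≡ 0)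
consecutive {q} {k@(suc _)} i i′ r r′ eq with suc (toℕ r) <? k
... | yes 1+r<k = let i′≡i , r′≡ = combine-injective i′ r′ i next (toℕ-injective same)
                  in inj₁ (sym i′≡i , trans (cong toℕ r′≡) (toℕ-fromℕ< 1+r<k))
  where
  open ≡-Reasoning
  next = fromℕ< 1+r<k
  same : toℕ (combine i′ r′) ≡ toℕ (combine i next)
  same = begin
    toℕ (combine i′ r′)          ≡⟨ eq ⟩
    suc (toℕ (combine i r))      ≡⟨ cong suc (toℕ-combine i r) ⟩
    suc (k * toℕ i + toℕ r)      ≡⟨ +-suc (k * toℕ i) (toℕ r) ⟨
    k * toℕ i + suc (toℕ r)      ≡⟨ cong (k * toℕ i +_) (toℕ-fromℕ< 1+r<k) ⟨
    k * toℕ i + toℕ next         ≡⟨ toℕ-combine i next ⟨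
    toℕ (combine i next)         ∎
... | no 1+r≮k = inj₂ (1+r≡k , r′≡0)
  where
  open ≡-Reasoning
  1+r≡k : suc (toℕ r) ≡ k
  1+r≡k = ≤-antisym (toℕ<n r) (≮⇒≥ 1+r≮k)
  r′≡0 : toℕ r′ ≡ 0
  r′≡0 = begin
    toℕ r′                         ≡⟨ toℕ-combine-% i′ r′ ⟨
    toℕ (combine i′ r′) % k        ≡⟨ cong (_% k) eq ⟩
    suc (toℕ (combine i r)) % k    ≡⟨ cong (λ m → suc m % k) (trans (toℕ-combine i r) (+-comm _ (toℕ r))) ⟩
    (suc (toℕ r) + k * toℕ i) % k  ≡⟨ cong (λ m → (suc (toℕ r) + m) % k) (*-comm k (toℕ i)) ⟩
    (suc (toℕ r) + toℕ i * k) % k  ≡⟨ [m+kn]%n≡m%n (suc (toℕ r)) (toℕ i) k ⟩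
    suc (toℕ r) % k                ≡⟨ cong (_% k) 1+r≡k ⟩
    k % k                          ≡⟨ n%n≡0 k ⟩
    0                              ∎

parity-even : 2 ∣ k → parity k ≡ 0ℙ
parity-even (divides m refl) = trans (*-homo-* m 2) (*-zeroʳ (parity m))

last-odd : ∀ {m} → 2 ∣ k → suc m ≡ k → parity m ≡ 1ℙ
last-odd {m = m} 2∣k refl = trans (sym (suc-homo-⁻¹ m)) (cong _⁻¹ (parity-even 2∣k))

-- Inside a block the residue grows by one; across a boundary it drops from `k - 1`, odd because `k`
-- is even, to `0`.
consecutive-parity : 2 ∣ k → (i i′ : Fin q) (r r′ : Fin k) →
  toℕ (combine i′ r′) ≡ suc (toℕ (combine i r)) → parity (toℕ r′) ≡ parity (toℕ r) ⁻¹
consecutive-parity {k} 2∣k i i′ r r′ eq with consecutive i i′ r r′ eq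
... | inj₁ (_ , r′≡1+r) = trans (cong parity r′≡1+r) (sym (⁻¹-selfInverse (suc-homo-⁻¹ (toℕ r))))
... | inj₂ (1+r≡k , r′≡0) =
  trans (cong parity r′≡0) (cong _⁻¹ (sym (last-odd 2∣k 1+r≡k)))

-- Residues advance by one modulo `k`, so stepping both ways would force `2` to vanish modulo `k`.
consecutive-irreversible : k > 2 → (i i′ j j′ : Fin q) (r r′ : Fin k) →
  toℕ (combine i′ r′) ≡ suc (toℕ (combine i r)) → ¬ (toℕ (combine j′ r) ≡ suc (toℕ (combine j r′)))
consecutive-irreversible k>2 i i′ j j′ r r′ eq eq′
  with consecutive i i′ r r′ eq | consecutive j j′ r′ r eq′
... | inj₁ (_ , r′≡1+r) | inj₁ (_ , r≡1+r′) =
  <⇒≢ (<-trans (n<1+n (toℕ r)) (n<1+n (suc (toℕ r)))) (trans r≡1+r′ (cong suc r′≡1+r))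
... | inj₁ (_ , r′≡1+r) | inj₂ (1+r′≡k , r≡0) =
  <⇒≢ k>2 (trans (cong (2 +_) (sym r≡0)) (trans (cong suc (sym r′≡1+r)) 1+r′≡k))
... | inj₂ (1+r≡k , r′≡0) | inj₁ (_ , r≡1+r′) =
  <⇒≢ k>2 (trans (cong (2 +_) (sym r′≡0)) (trans (cong suc (sym r≡1+r′)) 1+r≡k))
... | inj₂ (1+r≡k , r′≡0) | inj₂ (_ , r≡0) =
  <⇒≢ (<-trans (n<1+n 1) k>2) (trans (cong suc (sym r≡0)) 1+r≡k)

Joins-common : (π ρ : HamiltonPath n) {i j i′ j′ u v : Fin n} → Joins π i j u v → Joins ρ i′ j′ u v →
  (π ⟨$⟩ʳ i ≡ ρ ⟨$⟩ʳ i′ × π ⟨$⟩ʳ j ≡ ρ ⟨$⟩ʳ j′) ⊎ (π ⟨$⟩ʳ i ≡ ρ ⟨$⟩ʳ j′ × π ⟨$⟩ʳ j ≡ ρ ⟨$⟩ʳ i′)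
Joins-common π ρ (inj₁ (a , b)) (inj₁ (c , d)) = inj₁ (trans a (sym c) , trans b (sym d))
Joins-common π ρ (inj₁ (a , b)) (inj₂ (c , d)) = inj₂ (trans a (sym d) , trans b (sym c))
Joins-common π ρ (inj₂ (a , b)) (inj₁ (c , d)) = inj₂ (trans a (sym d) , trans b (sym c))
Joins-common π ρ (inj₂ (a , b)) (inj₂ (c , d)) = inj₁ (trans a (sym c) , trans b (sym d))

-- The even endpoint of the common edge is fixed by both orderings, so the edge sits at the same
-- position in both; comparing its odd endpoints gives the conclusion.
same-edge⇒agree : 2 ∣ k → (σ τ : Permutation′ q) (i i′ j j′ : Fin q) (r r′ s s′ : Fin k) →
  toℕ (combine i′ r′) ≡ suc (toℕ (combine i r)) → toℕ (combine j′ s′) ≡ suc (toℕ (combine j s)) →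
  interleave σ ⟨$⟩ʳ combine i r ≡ interleave τ ⟨$⟩ʳ combine j s →
  interleave σ ⟨$⟩ʳ combine i′ r′ ≡ interleave τ ⟨$⟩ʳ combine j′ s′ →
  σ ⟨$⟩ʳ i ≡ τ ⟨$⟩ʳ i
same-edge⇒agree {k} 2∣k σ τ i i′ j j′ r r′ s s′ eq eq′ u v
  with u₁ , refl ← same-vertex σ τ i j r s u
  with v₁ , refl ← same-vertex σ τ i′ j′ r′ s′ v
  with parity (toℕ r) in p | parity (toℕ r′) | consecutive-parity 2∣k i i′ r r′ eq | consecutive i i′ r r′ eq
... | 0ℙ | 1ℙ | _ | inj₁ (refl , _) =
  trans v₁ (cong (τ ⟨$⟩ʳ_) (proj₁ (combine-injective j′ r′ i r′ (toℕ-injective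
    (trans eq′ (trans (cong (λ l → suc (toℕ (combine l r))) (sym u₁)) (sym eq)))))))
-- An edge that starts at an even residue stays inside its block, since the last residue is odd.
... | 0ℙ | 1ℙ | _ | inj₂ (1+r≡k , _) with () ← trans (sym p) (last-odd 2∣k 1+r≡k)
... | 1ℙ | 0ℙ | _ | _ =
  trans u₁ (cong (τ ⟨$⟩ʳ_) (proj₁ (combine-injective j r i r (toℕ-injective (ℕ.suc-injective
    (trans (sym eq′) (trans (cong (λ l → toℕ (combine l r′)) (sym v₁)) eq)))))))

-- Because `z` has residue `0`, the window is one whole block; comparing multiples of `k` bounds
-- each block index by the other.
position-block : (i j : Fin q) (r z : Fin k) → toℕ z ≡ 0 →
  toℕ (combine i z) ≤ toℕ (combine j r) → toℕ (combine j r) < toℕ (combine i z) + k → i ≡ j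
position-block {k = k} i j r z z≡0 lb ub = toℕ-injective
  (≤-antisym (≤-pred (*-cancelˡ-< k (toℕ i) (suc (toℕ j)) (begin-strict
      k * toℕ i                 ≡⟨ start≡ ⟨
      toℕ (combine i z)         ≤⟨ lb ⟩
      toℕ (combine j r)         ≡⟨ toℕ-combine j r ⟩
      k * toℕ j + toℕ r         <⟨ +-monoʳ-< (k * toℕ j) (toℕ<n r) ⟩
      k * toℕ j + k             ≡⟨ +-comm _ k ⟩
      k + k * toℕ j             ≡⟨ *-suc k (toℕ j) ⟨
      k * suc (toℕ j)           ∎)))
    (≤-pred (*-cancelˡ-< k (toℕ j) (suc (toℕ i)) (begin-strict
      k * toℕ j                 ≤⟨ m≤m+n _ (toℕ r) ⟩
      k * toℕ j + toℕ r         ≡⟨ toℕ-combine j r ⟨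
      toℕ (combine j r)         <⟨ ub ⟩
      toℕ (combine i z) + k     ≡⟨ cong (_+ k) start≡ ⟩
      k * toℕ i + k             ≡⟨ +-comm _ k ⟩
      k + k * toℕ i             ≡⟨ *-suc k (toℕ i) ⟨
      k * suc (toℕ i)           ∎))))
  where
  open ≤-Reasoning
  start≡ : toℕ (combine i z) ≡ k * toℕ i
  start≡ = trans (toℕ-combine i z) (trans (cong (k * toℕ i +_) z≡0) (+-identityʳ _))

-- The witness is the subpath of the `k` edges that start in block `i`. The last of them ends in
-- block `i + 1`, which therefore has to exist.
disagree⇒avoiding : k > 2 → 2 ∣ k → (σ τ : Permutation′ q) (i : Fin q) →
  suc (toℕ i) < q → σ ⟨$⟩ʳ i ≢ τ ⟨$⟩ʳ i → HasSubpathAvoiding {q * k} k (interleave σ) (interleave τ)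
disagree⇒avoiding {k@(suc _)} {q} k>2 2∣k σ τ i 1+i<q σi≢τi = combine i zero , fits , disjoint
  where
  fits : toℕ (combine i zero) + k < q * k
  fits = begin-strict
    toℕ (combine i zero) + k    ≡⟨ cong (_+ k) (toℕ-combine {n = k} i zero) ⟩
    k * toℕ i + 0 + k           ≡⟨ cong (_+ k) (+-identityʳ (k * toℕ i)) ⟩
    k * toℕ i + k               ≡⟨ +-comm (k * toℕ i) k ⟩
    k + k * toℕ i               ≡⟨ *-suc k (toℕ i) ⟨
    k * suc (toℕ i)             <⟨ *-monoʳ-< k 1+i<q ⟩
    k * q                       ≡⟨ *-comm k q ⟩
    q * k                       ∎
    where open ≤-Reasoning

  disjoint : EdgeDisjoint (SubpathEdges (interleave σ) (toℕ (combine {n = k} i zero)) k) (Edges (interleave τ))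
  disjoint u v (p , p′ , (lb , ub) , eq , uv) (p₁ , p₁′ , eq₁ , uv₁)
    with a , r , refl ← combine-surjective {q} {k} p
    with a′ , r′ , refl ← combine-surjective {q} {k} p′
    with b , s , refl ← combine-surjective {q} {k} p₁
    with b′ , s′ , refl ← combine-surjective {q} {k} p₁′
    with refl ← position-block i a r zero refl lb ub
    with Joins-common (interleave σ) (interleave τ) uv uv₁
  ... | inj₁ (e , e′) = σi≢τi (same-edge⇒agree 2∣k σ τ a a′ b b′ r r′ s s′ eq eq₁ e e′)
  -- Both paths preserve residues, so an edge traversed in opposite directions would step from `r`
  -- to `r′` and also from `r′` to `r`.
  ... | inj₂ (e , e′)
    with _ , refl ← same-vertex σ τ a b′ r s′ e | _ , refl ← same-vertex σ τ a′ b r′ s e′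
    = consecutive-irreversible k>2 a a′ b b′ r r′ eq eq₁

-- If σ and τ disagree at i, they also disagree at τ⁻¹ (σ i), and one of the two is not the last index.
disagreement-not-last : (σ τ : Permutation′ q) → ¬ (σ ≈ τ) →
  ∃ λ i → suc (toℕ i) < q × σ ⟨$⟩ʳ i ≢ τ ⟨$⟩ʳ i
disagreement-not-last {q} σ τ σ≉τ
  with i , σi≢τi ← ¬∀⟶∃¬ q _ (λ i → σ ⟨$⟩ʳ i ≟ τ ⟨$⟩ʳ i) σ≉τ
  with suc (toℕ i) <? q
... | yes 1+i<q = i , 1+i<q , σi≢τi
... | no  1+i≮q = j , ≤∧≢⇒< (toℕ<n j) 1+j≢q , λ σj≡τj → i≢j (injective σ (sym (trans σj≡τj (inverseʳ τ))))
  where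
  j = τ ⟨$⟩ˡ (σ ⟨$⟩ʳ i)
  i≢j : i ≢ j
  i≢j i≡j = σi≢τi (trans (sym (inverseʳ τ)) (cong (τ ⟨$⟩ʳ_) (sym i≡j)))
  1+j≢q : suc (toℕ j) ≢ q
  1+j≢q 1+j≡q = i≢j (toℕ-injective (ℕ.suc-injective
    (trans (≤-antisym (toℕ<n i) (≮⇒≥ 1+i≮q)) (sym 1+j≡q))))

-- As `k > 0`, the avoiding subpath has a first edge, which would lie in both paths. Hence
-- separation already makes the members of the family distinct.
avoiding⇒≁ : .{{_ : NonZero k}} (π ρ : HamiltonPath n) → HasSubpathAvoiding k π ρ → ¬ (π ∼ ρ)
avoiding⇒≁ {k@(suc _)} {n} π ρ (s , s+k<n , disjoint) (π⊆ρ , _) =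
  disjoint (π ⟨$⟩ʳ s) (π ⟨$⟩ʳ t) (s , t , (≤-refl , m<m+n (toℕ s) (s≤s z≤n)) , step , inj₁ (refl , refl))
    (π⊆ρ (s , t , step , inj₁ (refl , refl)))
  where
  1+s<n : suc (toℕ s) < n
  1+s<n = ≤-trans (s≤s (m<m+n (toℕ s) (s≤s z≤n))) s+k<n
  t = fromℕ< 1+s<n
  step : toℕ t ≡ suc (toℕ s)
  step = toℕ-fromℕ< 1+s<n

interleaved-family : .{{_ : NonZero k}} → k > 2 → 2 ∣ k → SeparatedFamily (q * k) k (q !)
interleaved-family {k} {q} k>2 2∣k = record
  { path      = path
  ; distinct  = λ {c} {d} → distinct c d
  ; separated = λ c d c≢d → inj₁ (avoiding c d c≢d)
  }
  where
  σ : Fin (q !) → Permutation′ q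
  σ = decode
  path : Fin (q !) → HamiltonPath (q * k)
  path c = interleave (σ c)
  avoiding : ∀ c d → c ≢ d → HasSubpathAvoiding k (path c) (path d)
  avoiding c d c≢d =
    let i , 1+i<q , σci≢σdi = disagreement-not-last (σ c) (σ d) (c≢d ∘ decode-injective c d)
    in disagree⇒avoiding k>2 2∣k (σ c) (σ d) i 1+i<q σci≢σdi
  distinct : ∀ c d → path c ∼ path d → c ≡ d
  distinct c d c∼d with c ≟ d
  ... | yes c≡d = c≡d
  ... | no  c≢d = contradiction c∼d (avoiding⇒≁ (path c) (path d) (avoiding c d c≢d))

-- Upper bound

-- The search depends only on the value of `f`, so equal values get the same representative; the
-- given preimage only excludes a failed search. This will pick one reference path for each
-- colouring.
class-representative : ∀ {a} {A : Set a} → DecidableEquality A → (f : Fin n → A) →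
  ∃ λ (rep : Fin n → Fin n) → (∀ i → f (rep i) ≡ f i) × (∀ i j → f i ≡ f j → rep i ≡ rep j)
class-representative {n} {A = A} _≈?_ f =
  (λ i → choose (f i) (search (f i)) (i , refl)) ,
  (λ i → choose-correct (f i) (search (f i)) (i , refl)) ,
  (λ i j eq → choose-cong eq (i , refl) (j , refl))
  where
  Preimage : A → Set _
  Preimage x = ∃ λ l → f l ≡ x

  search : ∀ x → Dec (Preimage x)
  search x = any? λ l → f l ≈? x

  choose : ∀ x → Dec (Preimage x) → Preimage x → Fin n
  choose x (yes (l , _)) _ = l
  choose x (no ∄l)       p = contradiction p ∄l

  choose-correct : ∀ x (d : Dec (Preimage x)) (p : Preimage x) → f (choose x d p) ≡ x
  choose-correct x (yes (l , fl≡x)) _ = fl≡x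
  choose-correct x (no ∄l)          p = contradiction p ∄l

  choose-irrelevant : ∀ x (d : Dec (Preimage x)) (p p′ : Preimage x) → choose x d p ≡ choose x d p′
  choose-irrelevant x (yes _) _ _ = refl
  choose-irrelevant x (no ∄l) p _ = contradiction p ∄l

  choose-cong : ∀ {x y} → x ≡ y → (p : Preimage x) (p′ : Preimage y) →
    choose x (search x) p ≡ choose y (search y) p′
  choose-cong {x} refl p p′ = choose-irrelevant x (search x) p p′

-- A transversal of a path of Fin n consists of the m directed edges from position tail t to
-- position head t.  Colouring their tails, their heads and the other vertices differently leaves
-- only the matching of tails with heads undetermined.
module Transversal {m n : ℕ} (tail head : Fin m → Fin n)
  (tail-injective : Injective _≡_ _≡_ tail) (head-injective : Injective _≡_ _≡_ head)
  (tail≢head : ∀ t t′ → tail t ≢ head t′) where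

  mark : Fin n → Fin 3
  mark p with any? (λ t → tail t ≟ p) | any? (λ t → head t ≟ p)
  ... | yes _ | _     = 1F
  ... | no  _ | yes _ = 2F
  ... | no  _ | no  _ = 0F

  -- Abstracts what tails and heads share, so that `relabelling` covers both: `e` enumerates the
  -- positions of colour `c`.
  record MarkedBy (c : Fin 3) (e : Fin m → Fin n) : Set where
    field
      marked   : ∀ t → mark (e t) ≡ c
      unmarked : ∀ p → mark p ≡ c → ∃ λ t → e t ≡ p

  tail-marked : MarkedBy 1F tail
  tail-marked = record { marked = marked ; unmarked = unmarked }
    where
    marked : ∀ t → mark (tail t) ≡ 1F
    marked t with any? (λ t′ → tail t′ ≟ tail t) | any? (λ t′ → head t′ ≟ tail t)
    ... | yes _ | _ = refl
    ... | no ∄t | _ = contradiction (t , refl) ∄t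
    unmarked : ∀ p → mark p ≡ 1F → ∃ λ t → tail t ≡ p
    unmarked p eq with any? (λ t → tail t ≟ p) | any? (λ t → head t ≟ p)
    unmarked p eq | yes t∃ | _     = t∃
    unmarked p () | no _   | yes _
    unmarked p () | no _   | no _

  head-marked : MarkedBy 2F head
  head-marked = record { marked = marked ; unmarked = unmarked }
    where
    marked : ∀ t → mark (head t) ≡ 2F
    marked t with any? (λ t′ → tail t′ ≟ head t) | any? (λ t′ → head t′ ≟ head t)
    ... | yes (t′ , eq) | _     = contradiction eq (tail≢head t′ t)
    ... | no _          | yes _ = refl
    ... | no _          | no ∄t = contradiction (t , refl) ∄t
    unmarked : ∀ p → mark p ≡ 2F → ∃ λ t → head t ≡ p
    unmarked p eq with any? (λ t → tail t ≟ p) | any? (λ t → head t ≟ p)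
    unmarked p () | yes _ | _
    unmarked p eq | no _  | yes ∃t = ∃t
    unmarked p () | no _  | no _

  colour : HamiltonPath n → Fin n → Fin 3
  colour π v = mark (π ⟨$⟩ˡ v)

  -- Equal colours put the vertex at `e t` of `π` at some `e t′` of `ρ`; sending `t` to `t′` is
  -- inverted by exchanging the two paths.
  relabelling : ∀ {c e} → Injective _≡_ _≡_ e → MarkedBy c e → (π ρ : HamiltonPath n) →
    (∀ v → colour π v ≡ colour ρ v) →
    ∃ λ (α : Permutation′ m) → ∀ t → ρ ⟨$⟩ʳ e (α ⟨$⟩ʳ t) ≡ π ⟨$⟩ʳ e t
  relabelling {c} {e} e-injective e-marked π ρ same =
    permutation (λ t → proj₁ (forth t)) (λ t → proj₁ (back t))
      (λ t → e-injective (injective ρ (trans (proj₂ (forth _)) (proj₂ (back t)))))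
      (λ t → e-injective (injective π (trans (proj₂ (back _)) (proj₂ (forth t)))))
    , proj₂ ∘ forth
    where
    open MarkedBy e-marked
    open ≡-Reasoning
    transfer : (π ρ : HamiltonPath n) → (∀ v → colour π v ≡ colour ρ v) →
      ∀ t → ∃ λ t′ → ρ ⟨$⟩ʳ e t′ ≡ π ⟨$⟩ʳ e t
    transfer π ρ same t =
      let t′ , eq = unmarked (ρ ⟨$⟩ˡ (π ⟨$⟩ʳ e t)) (begin
            colour ρ (π ⟨$⟩ʳ e t)  ≡⟨ same (π ⟨$⟩ʳ e t) ⟨
            colour π (π ⟨$⟩ʳ e t)  ≡⟨ cong mark (inverseˡ π) ⟩
            mark (e t)             ≡⟨ marked t ⟩
            c                      ∎)
      in t′ , trans (cong (ρ ⟨$⟩ʳ_) eq) (inverseʳ ρ)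
    forth : ∀ t → ∃ λ t′ → ρ ⟨$⟩ʳ e t′ ≡ π ⟨$⟩ʳ e t
    forth = transfer π ρ same
    back : ∀ t → ∃ λ t′ → π ⟨$⟩ʳ e t′ ≡ ρ ⟨$⟩ʳ e t
    back = transfer ρ π (sym ∘ same)

  -- Inclusion of the sets of directed transversal edges.
  _⊑_ : HamiltonPath n → HamiltonPath n → Set
  π ⊑ ρ = ∀ t → ∃ λ t′ → π ⟨$⟩ʳ tail t ≡ ρ ⟨$⟩ʳ tail t′ × π ⟨$⟩ʳ head t ≡ ρ ⟨$⟩ʳ head t′

  -- The matching of tails with heads in π, transported to the edge labels of the path ρ.
  module Matching (π ρ : HamiltonPath n) (same : ∀ v → colour π v ≡ colour ρ v) where
    tails heads matching : Permutation′ m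
    tails    = proj₁ (relabelling tail-injective tail-marked π ρ same)
    heads    = proj₁ (relabelling head-injective head-marked π ρ same)
    matching = flip tails ∘ₚ heads

    tails-correct : ∀ t → ρ ⟨$⟩ʳ tail (tails ⟨$⟩ʳ t) ≡ π ⟨$⟩ʳ tail t
    tails-correct = proj₂ (relabelling tail-injective tail-marked π ρ same)
    heads-correct : ∀ t → ρ ⟨$⟩ʳ head (heads ⟨$⟩ʳ t) ≡ π ⟨$⟩ʳ head t
    heads-correct = proj₂ (relabelling head-injective head-marked π ρ same)

  -- Both matchings use the labels of the same path `ρ`, so their equality means that each tail
  -- vertex has the same head vertex in `π` as in `π′`.
  same-matching⇒⊑ : (π π′ ρ : HamiltonPath n)
    (same : ∀ v → colour π v ≡ colour ρ v) (same′ : ∀ v → colour π′ v ≡ colour ρ v) →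
    Matching.matching π ρ same ≈ Matching.matching π′ ρ same′ → π ⊑ π′
  same-matching⇒⊑ π π′ ρ same same′ eq t = t′ , tails≡ , heads≡
    where
    open ≡-Reasoning
    open Matching π ρ same
    open Matching π′ ρ same′ using () renaming
      (tails to tails′; heads to heads′; tails-correct to tails-correct′; heads-correct to heads-correct′)
    -- The label of the transversal edge of `π′` whose tail is the same vertex as that of edge `t`
    -- of `π`.
    t′ = tails′ ⟨$⟩ˡ (tails ⟨$⟩ʳ t)
    tails≡ : π ⟨$⟩ʳ tail t ≡ π′ ⟨$⟩ʳ tail t′
    tails≡ = begin
      π ⟨$⟩ʳ tail t                      ≡⟨ tails-correct t ⟨
      ρ ⟨$⟩ʳ tail (tails ⟨$⟩ʳ t)         ≡⟨ cong (λ s → ρ ⟨$⟩ʳ tail s) (inverseʳ tails′) ⟨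
      ρ ⟨$⟩ʳ tail (tails′ ⟨$⟩ʳ t′)       ≡⟨ tails-correct′ t′ ⟩
      π′ ⟨$⟩ʳ tail t′                    ∎
    heads≡ : π ⟨$⟩ʳ head t ≡ π′ ⟨$⟩ʳ head t′
    heads≡ = begin
      π ⟨$⟩ʳ head t                                ≡⟨ heads-correct t ⟨
      ρ ⟨$⟩ʳ head (heads ⟨$⟩ʳ t)                   ≡⟨ cong (λ s → ρ ⟨$⟩ʳ head (heads ⟨$⟩ʳ s)) (inverseˡ tails) ⟨
      ρ ⟨$⟩ʳ head (matching ⟨$⟩ʳ (tails ⟨$⟩ʳ t))   ≡⟨ cong (λ s → ρ ⟨$⟩ʳ head s) (eq (tails ⟨$⟩ʳ t)) ⟩
      ρ ⟨$⟩ʳ head (heads′ ⟨$⟩ʳ t′)                 ≡⟨ heads-correct′ t′ ⟩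
      π′ ⟨$⟩ʳ head t′                              ∎

  palette : HamiltonPath n → Fin (3 ^ n)
  palette π = funToFin (colour π)

  same-palette : (π ρ : HamiltonPath n) → palette π ≡ palette ρ → ∀ v → colour π v ≡ colour ρ v
  same-palette π ρ eq v = trans (sym (finToFun-funToFin (colour π) v))
    (trans (cong (λ c → finToFun c v) eq) (finToFun-funToFin (colour ρ) v))

  -- Matchings are compared against a common reference path; `rep` supplies one that depends on the
  -- palette alone.
  module Coding {size} (path : Fin size → HamiltonPath n) (rep : Fin size → Fin size)
    (to-rep : ∀ i v → colour (path i) v ≡ colour (path (rep i)) v)
    (rep-cong : ∀ i j → palette (path i) ≡ palette (path j) → rep i ≡ rep j) where

    matching : Fin size → Permutation′ m
    matching i = Matching.matching (path i) (path (rep i)) (to-rep i)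

    code : Fin size → Fin (3 ^ n * m !)
    code i = combine (palette (path i)) (encode (matching i))

    -- Variables `r` and `r′` stand for `rep i` and `rep j`, so that their equality can be matched
    -- with `refl` although the matchings depend on them.
    ⊑-at : ∀ i j {r r′} → r ≡ r′ → (same : ∀ v → colour (path i) v ≡ colour (path r) v)
      (same′ : ∀ v → colour (path j) v ≡ colour (path r′) v) →
      Matching.matching (path i) (path r) same ≈ Matching.matching (path j) (path r′) same′ →
      path i ⊑ path j
    ⊑-at i j {r} refl same same′ = same-matching⇒⊑ (path i) (path j) (path r) same same′

    code-⊑ : ∀ i j → code i ≡ code j → path i ⊑ path j
    code-⊑ i j eq = ⊑-at i j (rep-cong i j (proj₁ eqs)) (to-rep i) (to-rep j)
      (encode-injective (matching i) (matching j) (proj₂ eqs))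
      where
      eqs : palette (path i) ≡ palette (path j) × encode (matching i) ≡ encode (matching j)
      eqs = combine-injective (palette (path i)) (encode (matching i)) (palette (path j)) (encode (matching j)) eq

  bound : ∀ {size} (path : Fin size → HamiltonPath n) →
    (∀ i j → path i ⊑ path j → path j ⊑ path i → i ≡ j) → size ≤ 3 ^ n * m !
  bound {size} path antisym
    with rep , rep-palette , rep-cong ← class-representative _≟_ (λ i → palette (path i))
    = injective⇒≤ {f = code} λ {i} {j} eq → antisym i j (code-⊑ i j eq) (code-⊑ j i (sym eq))
    where
    open Coding path rep
      (λ i → same-palette (path i) (path (rep i)) (sym (rep-palette i))) rep-cong

-- One edge in every k, so that each subpath with k edges contains one of them.
module PeriodicEdges (m k-1 : ℕ) (0<k-1 : 0 < k-1) where

  k′ n′ : ℕ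
  k′ = suc k-1
  n′ = suc m * k′

  -- The edges joining block `t` to block `t + 1`: there are `m` boundaries between `m + 1` blocks.
  tail head : Fin m → Fin n′
  tail t = combine (inject₁ t) (fromℕ k-1)
  head t = combine {suc m} (suc t) (zero {k-1})

  toℕ-tail : ∀ t → toℕ (tail t) ≡ k′ * toℕ t + k-1
  toℕ-tail t = trans (toℕ-combine (inject₁ t) (fromℕ k-1))
    (cong₂ (λ i r → k′ * i + r) (toℕ-inject₁ t) (toℕ-fromℕ k-1))

  head-after-tail : ∀ t → toℕ (head t) ≡ suc (toℕ (tail t))
  head-after-tail t = begin
    toℕ (head t)                  ≡⟨ toℕ-combine {suc m} (suc t) (zero {k-1}) ⟩
    k′ * suc (toℕ t) + 0          ≡⟨ +-identityʳ (k′ * suc (toℕ t)) ⟩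
    k′ * suc (toℕ t)              ≡⟨ *-suc k′ (toℕ t) ⟩
    k′ + k′ * toℕ t               ≡⟨ +-comm k′ (k′ * toℕ t) ⟩
    k′ * toℕ t + k′               ≡⟨ +-suc (k′ * toℕ t) k-1 ⟩
    suc (k′ * toℕ t + k-1)        ≡⟨ cong suc (toℕ-tail t) ⟨
    suc (toℕ (tail t))            ∎
    where open ≡-Reasoning

  tail-injective : Injective _≡_ _≡_ tail
  tail-injective eq = inject₁-injective (proj₁ (combine-injective _ (fromℕ k-1) _ (fromℕ k-1) eq))

  head-injective : Injective _≡_ _≡_ head
  head-injective {t} {t′} eq =
    suc-injective (proj₁ (combine-injective {suc m} (suc t) (zero {k-1}) (suc t′) zero eq))

  -- Tails have residue `k - 1` and heads residue `0`; these differ because blocks have length at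
  -- least two.
  tail≢head : ∀ t t′ → tail t ≢ head t′
  tail≢head t t′ eq = <⇒≢ 0<k-1 (trans (sym (cong toℕ last≡0)) (toℕ-fromℕ k-1))
    where
    last≡0 : fromℕ k-1 ≡ zero
    last≡0 = proj₂ (combine-injective (inject₁ t) (fromℕ k-1) (suc t′) zero eq)

  open Transversal tail head tail-injective head-injective tail≢head public

  -- The end of the block of `s` is at most `k - 1` positions after `s`. Since the window fits into
  -- the path, this block is not the last one, so its end is a tail.
  tail-in-window : ∀ s → s + k′ < n′ → ∃ λ t → s ≤ toℕ (tail t) × toℕ (tail t) < s + k′
  tail-in-window s s+k<n = t , lower , upper
    where
    open ≤-Reasoning
    s<m*k : s < m * k′
    s<m*k = +-cancelʳ-< k′ s (m * k′) (subst (s + k′ <_) (+-comm k′ (m * k′)) s+k<n)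
    t = fromℕ< (m<n*o⇒m/o<n s<m*k)
    tail≡ : toℕ (tail t) ≡ s / k′ * k′ + k-1
    tail≡ = trans (toℕ-tail t)
      (cong (_+ k-1) (trans (cong (k′ *_) (toℕ-fromℕ< (m<n*o⇒m/o<n s<m*k))) (*-comm k′ (s / k′))))
    lower : s ≤ toℕ (tail t)
    lower = begin
      s                          ≡⟨ m≡m%n+[m/n]*n s k′ ⟩
      s % k′ + s / k′ * k′       ≡⟨ +-comm (s % k′) _ ⟩
      s / k′ * k′ + s % k′       ≤⟨ +-monoʳ-≤ (s / k′ * k′) (≤-pred (m%n<n s k′)) ⟩
      s / k′ * k′ + k-1          ≡⟨ tail≡ ⟨
      toℕ (tail t)               ∎
    upper : toℕ (tail t) < s + k′
    upper = begin-strict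
      toℕ (tail t)               ≡⟨ tail≡ ⟩
      s / k′ * k′ + k-1          <⟨ +-monoʳ-< (s / k′ * k′) (n<1+n k-1) ⟩
      s / k′ * k′ + k′           ≤⟨ +-monoˡ-≤ k′ (m/n*n≤m s k′) ⟩
      s + k′                     ∎

  ⊑⇒¬avoiding : (π ρ : HamiltonPath n′) → π ⊑ ρ → ¬ HasSubpathAvoiding k′ π ρ
  ⊑⇒¬avoiding π ρ π⊑ρ (s , s+k<n , disjoint) =
    let t , inside        = tail-in-window (toℕ s) s+k<n
        t′ , tail≡ , head≡ = π⊑ρ t
    in disjoint (π ⟨$⟩ʳ tail t) (π ⟨$⟩ʳ head t)
         (tail t , head t , inside , head-after-tail t , inj₁ (refl , refl))
         (tail t′ , head t′ , head-after-tail t′ , inj₁ (sym tail≡ , sym head≡))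

  family-bound : ∀ {size} → SeparatedFamily n′ k′ size → size ≤ 3 ^ n′ * m !
  family-bound F = bound path λ i j i⊑j j⊑i → decidable-stable (i ≟ j) λ i≢j →
    [ ⊑⇒¬avoiding (path i) (path j) i⊑j , ⊑⇒¬avoiding (path j) (path i) j⊑i ]′ (separated i j i≢j)
    where open SeparatedFamily F

theorem2 : (n k : ℕ) .{{_ : NonZero n}} .{{_ : NonZero k}} →
    k > 2 → 2 ∣ k → k ∣ n →
    ((n / k) ! ≤ M n k) × (M n k ≤ 3 ^ n * (n / k) !)
-- The quotient is a successor because `n` is nonzero.
theorem2 n k@(suc k-1) k>2 2∣k (divides (suc m) refl) =
  subst (λ q → (q ! ≤ M n k) × (M n k ≤ 3 ^ n * q !)) (sym (m*n/n≡m (suc m) k))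
    ( proj₂ (M-isMaximum n k) (suc m !) (interleaved-family {q = suc m} k>2 2∣k)
    , ≤-trans (family-bound {M n k} (proj₁ (M-isMaximum n k)))
        -- Only the `m` boundaries between `suc m` blocks are matched, so `m !` is weakened to
        -- `(suc m) !`.
        (*-monoʳ-≤ (3 ^ n) (m≤n*m (m !) (suc m))) )
  where open PeriodicEdges m k-1 (<-trans z<s (≤-pred k>2))
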